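{- Let $R$ be a Noetherian integral domain and let $G$ be an edge-labeled graph over $R$ in which every edge label is a principal ideal. If for every pair of distinct edge labels $I_i$ and $I_j$ we have $I_i+I_j=R$ (i.e. the edge schemes $\operatorname{Spec}(R/I_i)$ are pairwise disjoint), then $R_G$ is a projective $R$-module. If $R$ is a PID, or $R$ is of the form $A[x_1,\dots,x_n]$ with $A$ a PID or a field, then $R_G$ is also free.
   Context: An edge-labeled graph $G$ over $R$ is a finite graph $(V,E)$ with a map $\alpha$ from $E$ to the set of ideals of $R$. A spline is a function $s:V\to R$ with $s(u)-s(v)\in\alpha(e_{uv})$ for every edge $e_{uv}$ joining $u$ and $v$; the splines form a ring $R_G$ under pointwise operations, which is an $R$-module via constant splines. -}

module Defs where

open import Level using (_⊔_; suc)
open import Algebra.Bundles using (CommutativeRing)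
open import Algebra.Structures using (IsCommutativeRing)
open import Algebra.Module.Bundles using (Module)
open import Algebra.Module.Structures.Biased using (IsModuleFromLeft)
import Algebra.Module.Morphism.Structures as ModuleMorphismStructures
open import Algebra.Morphism.Structures using (IsRingIsomorphism)
import Algebra.Definitions.RawMonoid as RawMonoidSum
import Algebra.Properties.CommutativeSemigroup as CommutativeSemigroupProperties
import Algebra.Properties.Ring as RingProperties
open import Data.Fin.Base using (Fin)
open import Data.List.Base using (List; []; _∷_; map)
open import Data.Nat.Base using (ℕ; zero) renaming (suc to sucℕ)
open import Data.Product.Base using (Σ; ∃; _×_; _,_)
open import Data.Sum.Base using (_⊎_)
open import Data.Unit.Polymorphic.Base using (⊤; tt)
open import Data.Vec.Functional using (Vector)
open import Function.Base using (_∘_; const)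
open import Function.Definitions using (Injective; Surjective)
open import Relation.Binary.Bundles using (Setoid)
open import Relation.Binary.PropositionalEquality.Core using (_≡_)
import Relation.Binary.Reasoning.Setoid as SetoidReasoning
open import Relation.Nullary.Negation.Core using (¬_)
open import Relation.Unary using (Pred; _∈_; _≐_)

------------------------------------------------------------------------
-- Ideals

record Ideal {c ℓ} (R : CommutativeRing c ℓ) : Set (suc (c ⊔ ℓ)) where
  open CommutativeRing R
  field
    members   : Pred Carrier (c ⊔ ℓ)
    resp-≈    : ∀ {x y} → x ≈ y → x ∈ members → y ∈ members
    0∈        : 0# ∈ members
    +-closed  : ∀ {x y} → x ∈ members → y ∈ members → x + y ∈ members
    *-absorbs : ∀ r {x} → x ∈ members → r * x ∈ members

open Ideal using (members)

module _ {c ℓ} {R : CommutativeRing c ℓ} where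
  open CommutativeRing R
  open SetoidReasoning setoid
  open RawMonoidSum +-rawMonoid using (sum)

  infix  4 _≈ᴵ_
  infixl 6 _+ᴵ_

  _≈ᴵ_ : Ideal R → Ideal R → Set (c ⊔ ℓ)
  I ≈ᴵ J = members I ≐ members J

  unitIdeal : Ideal R
  unitIdeal = record
    { members   = λ _ → ⊤
    ; resp-≈    = λ _ _ → tt
    ; 0∈        = tt
    ; +-closed  = λ _ _ → tt
    ; *-absorbs = λ _ _ → tt
    }

  _+ᴵ_ : Ideal R → Ideal R → Ideal R
  I +ᴵ J = record
    { members   = λ x → ∃ λ a → ∃ λ b → a ∈ members I × b ∈ members J × x ≈ a + b
    ; resp-≈    = λ { x≈y (a , b , a∈I , b∈J , x≈a+b) →
                      a , b , a∈I , b∈J , trans (sym x≈y) x≈a+b }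
    ; 0∈        = 0# , 0# , I.0∈ , J.0∈ , sym (+-identityˡ 0#)
    ; +-closed  = λ { (a , b , a∈I , b∈J , x≈a+b) (a′ , b′ , a′∈I , b′∈J , y≈a′+b′) →
                      a + a′ , b + b′ , I.+-closed a∈I a′∈I , J.+-closed b∈J b′∈J ,
                      trans (+-cong x≈a+b y≈a′+b′) (interchange a b a′ b′) }
    ; *-absorbs = λ { r (a , b , a∈I , b∈J , x≈a+b) →
                      r * a , r * b , I.*-absorbs r a∈I , J.*-absorbs r b∈J ,
                      trans (*-congˡ x≈a+b) (distribˡ r a b) }
    }
    where
    module I = Ideal I
    module J = Ideal J
    open CommutativeSemigroupProperties +-commutativeSemigroup using (interchange)

  IsPrincipal : Ideal R → Set (c ⊔ ℓ)
  IsPrincipal I = ∃ λ a → members I ≐ λ x → ∃ λ r → x ≈ r * a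

  IsFinitelyGenerated : Ideal R → Set (c ⊔ ℓ)
  IsFinitelyGenerated I =
    ∃ λ n → Σ (Vector Carrier n) λ g →
    members I ≐ λ x → Σ (Vector Carrier n) λ r → x ≈ sum (λ i → r i * g i)

------------------------------------------------------------------------
-- Classes of rings

module _ {c ℓ} (R : CommutativeRing c ℓ) where
  open CommutativeRing R

  IsIntegralDomain : Set (c ⊔ ℓ)
  IsIntegralDomain = ¬ (1# ≈ 0#) × (∀ x y → x * y ≈ 0# → x ≈ 0# ⊎ y ≈ 0#)

  IsField : Set (c ⊔ ℓ)
  IsField = ¬ (1# ≈ 0#) × (∀ x → ¬ (x ≈ 0#) → ∃ λ y → x * y ≈ 1#)

  IsNoetherian : Set (suc (c ⊔ ℓ))
  IsNoetherian = (I : Ideal R) → IsFinitelyGenerated I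

  IsPID : Set (suc (c ⊔ ℓ))
  IsPID = IsIntegralDomain × ((I : Ideal R) → IsPrincipal I)

------------------------------------------------------------------------
-- Polynomial rings

-- A polynomial is its list of coefficients, constant term first; trailing
-- zeros are allowed, so equality compares coefficients.

module Univariate {c ℓ} (A : CommutativeRing c ℓ) where
  open CommutativeRing A

  Polynomial : Set c
  Polynomial = List Carrier

  coeff : Polynomial → ℕ → Carrier
  coeff []      _        = 0#
  coeff (a ∷ p) zero     = a
  coeff (a ∷ p) (sucℕ k) = coeff p k

  infix  4 _≈ₚ_
  infixl 6 _+ₚ_
  infixl 7 _*ₚ_
  infixr 7 _·ₚ_
  infix  8 -ₚ_

  -- A record, so that the two polynomials can be inferred from a proof.
  record _≈ₚ_ (p q : Polynomial) : Set ℓ where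
    constructor coeffwise
    field at : ∀ k → coeff p k ≈ coeff q k

  open _≈ₚ_

  _+ₚ_ : Polynomial → Polynomial → Polynomial
  []      +ₚ q       = q
  (a ∷ p) +ₚ []      = a ∷ p
  (a ∷ p) +ₚ (b ∷ q) = (a + b) ∷ (p +ₚ q)

  -ₚ_ : Polynomial → Polynomial
  -ₚ_ = map (-_)

  _·ₚ_ : Carrier → Polynomial → Polynomial
  a ·ₚ p = map (a *_) p

  _*ₚ_ : Polynomial → Polynomial → Polynomial
  []      *ₚ q = []
  (a ∷ p) *ₚ q = a ·ₚ q +ₚ (0# ∷ p *ₚ q)

  private
    module AP = RingProperties ring
    module AS = SetoidReasoning setoid
    open CommutativeSemigroupProperties +-commutativeSemigroup
      using () renaming (interchange to +-interchange)

    coeff-+ : ∀ p q k → coeff (p +ₚ q) k ≈ coeff p k + coeff q k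
    coeff-+ []      q       k        = sym (+-identityˡ _)
    coeff-+ (a ∷ p) []      k        = sym (+-identityʳ _)
    coeff-+ (a ∷ p) (b ∷ q) zero     = refl
    coeff-+ (a ∷ p) (b ∷ q) (sucℕ k) = coeff-+ p q k

    coeff-neg : ∀ p k → coeff (-ₚ p) k ≈ - coeff p k
    coeff-neg []      k        = sym AP.-0#≈0#
    coeff-neg (a ∷ p) zero     = refl
    coeff-neg (a ∷ p) (sucℕ k) = coeff-neg p k

    coeff-· : ∀ a p k → coeff (a ·ₚ p) k ≈ a * coeff p k
    coeff-· a []      k        = sym (zeroʳ a)
    coeff-· a (b ∷ p) zero     = refl
    coeff-· a (b ∷ p) (sucℕ k) = coeff-· a p k

    ≈ₚ-refl : ∀ {p} → p ≈ₚ p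
    ≈ₚ-refl = coeffwise λ _ → refl

    ≈ₚ-sym : ∀ {p q} → p ≈ₚ q → q ≈ₚ p
    ≈ₚ-sym p≈q = coeffwise λ k → sym (at p≈q k)

    ≈ₚ-trans : ∀ {p q r} → p ≈ₚ q → q ≈ₚ r → p ≈ₚ r
    ≈ₚ-trans p≈q q≈r = coeffwise λ k → trans (at p≈q k) (at q≈r k)

    ∷-cong : ∀ {a b p q} → a ≈ b → p ≈ₚ q → a ∷ p ≈ₚ b ∷ q
    ∷-cong a≈b p≈q = coeffwise λ { zero → a≈b ; (sucℕ k) → at p≈q k }

    0∷[] : 0# ∷ [] ≈ₚ []
    0∷[] = coeffwise λ { zero → refl ; (sucℕ k) → refl }

    +ₚ-cong : ∀ {p p′ q q′} → p ≈ₚ p′ → q ≈ₚ q′ → p +ₚ q ≈ₚ p′ +ₚ q′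
    +ₚ-cong {p} {p′} {q} {q′} p≈p′ q≈q′ = coeffwise λ k →
      trans (coeff-+ p q k) (trans (+-cong (at p≈p′ k) (at q≈q′ k)) (sym (coeff-+ p′ q′ k)))

    +ₚ-assoc : ∀ p q r → (p +ₚ q) +ₚ r ≈ₚ p +ₚ (q +ₚ r)
    +ₚ-assoc p q r = coeffwise λ k → let open AS in begin
      coeff ((p +ₚ q) +ₚ r) k               ≈⟨ coeff-+ (p +ₚ q) r k ⟩
      coeff (p +ₚ q) k + coeff r k          ≈⟨ +-congʳ (coeff-+ p q k) ⟩
      (coeff p k + coeff q k) + coeff r k   ≈⟨ +-assoc _ _ _ ⟩
      coeff p k + (coeff q k + coeff r k)   ≈⟨ +-congˡ (coeff-+ q r k) ⟨
      coeff p k + coeff (q +ₚ r) k          ≈⟨ coeff-+ p (q +ₚ r) k ⟨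
      coeff (p +ₚ (q +ₚ r)) k               ∎

    +ₚ-comm : ∀ p q → p +ₚ q ≈ₚ q +ₚ p
    +ₚ-comm p q = coeffwise λ k →
      trans (coeff-+ p q k) (trans (+-comm _ _) (sym (coeff-+ q p k)))

    +ₚ-identityʳ : ∀ p → p +ₚ [] ≈ₚ p
    +ₚ-identityʳ p = +ₚ-comm p []

    -ₚ-cong : ∀ {p q} → p ≈ₚ q → -ₚ p ≈ₚ -ₚ q
    -ₚ-cong {p} {q} p≈q = coeffwise λ k →
      trans (coeff-neg p k) (trans (-‿cong (at p≈q k)) (sym (coeff-neg q k)))

    -ₚ-inverseˡ : ∀ p → -ₚ p +ₚ p ≈ₚ []
    -ₚ-inverseˡ p = coeffwise λ k →
      trans (coeff-+ (-ₚ p) p k) (trans (+-congʳ (coeff-neg p k)) (-‿inverseˡ _))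

    -ₚ-inverseʳ : ∀ p → p +ₚ -ₚ p ≈ₚ []
    -ₚ-inverseʳ p = ≈ₚ-trans (+ₚ-comm p (-ₚ p)) (-ₚ-inverseˡ p)

    +ₚ-interchange : ∀ p q r s → (p +ₚ q) +ₚ (r +ₚ s) ≈ₚ (p +ₚ r) +ₚ (q +ₚ s)
    +ₚ-interchange p q r s = coeffwise λ k → let open AS in begin
      coeff ((p +ₚ q) +ₚ (r +ₚ s)) k                        ≈⟨ coeff-+ (p +ₚ q) (r +ₚ s) k ⟩
      coeff (p +ₚ q) k + coeff (r +ₚ s) k                   ≈⟨ +-cong (coeff-+ p q k) (coeff-+ r s k) ⟩
      (coeff p k + coeff q k) + (coeff r k + coeff s k)     ≈⟨ +-interchange _ _ _ _ ⟩
      (coeff p k + coeff r k) + (coeff q k + coeff s k)     ≈⟨ +-cong (coeff-+ p r k) (coeff-+ q s k) ⟨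
      coeff (p +ₚ r) k + coeff (q +ₚ s) k                   ≈⟨ coeff-+ (p +ₚ r) (q +ₚ s) k ⟨
      coeff ((p +ₚ r) +ₚ (q +ₚ s)) k                        ∎

    ·ₚ-cong : ∀ {a b p q} → a ≈ b → p ≈ₚ q → a ·ₚ p ≈ₚ b ·ₚ q
    ·ₚ-cong {a} {b} {p} {q} a≈b p≈q = coeffwise λ k →
      trans (coeff-· a p k) (trans (*-cong a≈b (at p≈q k)) (sym (coeff-· b q k)))

    ·ₚ-distribˡ : ∀ a p q → a ·ₚ (p +ₚ q) ≈ₚ a ·ₚ p +ₚ a ·ₚ q
    ·ₚ-distribˡ a p q = coeffwise λ k → let open AS in begin
      coeff (a ·ₚ (p +ₚ q)) k               ≈⟨ coeff-· a (p +ₚ q) k ⟩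
      a * coeff (p +ₚ q) k                  ≈⟨ *-congˡ (coeff-+ p q k) ⟩
      a * (coeff p k + coeff q k)           ≈⟨ distribˡ _ _ _ ⟩
      a * coeff p k + a * coeff q k         ≈⟨ +-cong (coeff-· a p k) (coeff-· a q k) ⟨
      coeff (a ·ₚ p) k + coeff (a ·ₚ q) k   ≈⟨ coeff-+ (a ·ₚ p) (a ·ₚ q) k ⟨
      coeff (a ·ₚ p +ₚ a ·ₚ q) k            ∎

    ·ₚ-distribʳ : ∀ a b p → (a + b) ·ₚ p ≈ₚ a ·ₚ p +ₚ b ·ₚ p
    ·ₚ-distribʳ a b p = coeffwise λ k → let open AS in begin
      coeff ((a + b) ·ₚ p) k                ≈⟨ coeff-· (a + b) p k ⟩
      (a + b) * coeff p k                   ≈⟨ distribʳ _ _ _ ⟩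
      a * coeff p k + b * coeff p k         ≈⟨ +-cong (coeff-· a p k) (coeff-· b p k) ⟨
      coeff (a ·ₚ p) k + coeff (b ·ₚ p) k   ≈⟨ coeff-+ (a ·ₚ p) (b ·ₚ p) k ⟨
      coeff (a ·ₚ p +ₚ b ·ₚ p) k            ∎

    ·ₚ-assoc : ∀ a b p → (a * b) ·ₚ p ≈ₚ a ·ₚ b ·ₚ p
    ·ₚ-assoc a b p = coeffwise λ k → let open AS in begin
      coeff ((a * b) ·ₚ p) k   ≈⟨ coeff-· (a * b) p k ⟩
      (a * b) * coeff p k      ≈⟨ *-assoc _ _ _ ⟩
      a * (b * coeff p k)      ≈⟨ *-congˡ (coeff-· b p k) ⟨
      a * coeff (b ·ₚ p) k     ≈⟨ coeff-· a (b ·ₚ p) k ⟨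
      coeff (a ·ₚ b ·ₚ p) k    ∎

    0·ₚ : ∀ p → 0# ·ₚ p ≈ₚ []
    0·ₚ p = coeffwise λ k → trans (coeff-· 0# p k) (zeroˡ _)

    1·ₚ : ∀ p → 1# ·ₚ p ≈ₚ p
    1·ₚ p = coeffwise λ k → trans (coeff-· 1# p k) (*-identityˡ _)

    ≈ₚ-setoid : Setoid c ℓ
    ≈ₚ-setoid = record
      { Carrier       = Polynomial
      ; _≈_           = _≈ₚ_
      ; isEquivalence = record { refl = ≈ₚ-refl ; sym = ≈ₚ-sym ; trans = ≈ₚ-trans }
      }

    module PS = SetoidReasoning ≈ₚ-setoid

    0∷-+ : ∀ p q → 0# ∷ (p +ₚ q) ≈ₚ (0# ∷ p) +ₚ (0# ∷ q)
    0∷-+ p q = ∷-cong (sym (+-identityˡ 0#)) ≈ₚ-refl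

    *ₚ-congˡ : ∀ p {q q′} → q ≈ₚ q′ → p *ₚ q ≈ₚ p *ₚ q′
    *ₚ-congˡ []      q≈q′ = ≈ₚ-refl
    *ₚ-congˡ (a ∷ p) q≈q′ =
      +ₚ-cong (·ₚ-cong refl q≈q′) (∷-cong refl (*ₚ-congˡ p q≈q′))

    *ₚ-zeroʳ : ∀ p → p *ₚ [] ≈ₚ []
    *ₚ-zeroʳ []      = ≈ₚ-refl
    *ₚ-zeroʳ (a ∷ p) = ≈ₚ-trans (∷-cong refl (*ₚ-zeroʳ p)) 0∷[]

    *ₚ-∷ : ∀ p b q → p *ₚ (b ∷ q) ≈ₚ b ·ₚ p +ₚ (0# ∷ p *ₚ q)
    *ₚ-∷ []      b q = ≈ₚ-sym 0∷[]
    *ₚ-∷ (a ∷ p) b q = ∷-cong (+-congʳ (*-comm a b)) (let open PS in begin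
      a ·ₚ q +ₚ p *ₚ (b ∷ q)                    ≈⟨ +ₚ-cong ≈ₚ-refl (*ₚ-∷ p b q) ⟩
      a ·ₚ q +ₚ (b ·ₚ p +ₚ (0# ∷ p *ₚ q))       ≈⟨ +ₚ-assoc (a ·ₚ q) _ _ ⟨
      (a ·ₚ q +ₚ b ·ₚ p) +ₚ (0# ∷ p *ₚ q)       ≈⟨ +ₚ-cong (+ₚ-comm (a ·ₚ q) _) ≈ₚ-refl ⟩
      (b ·ₚ p +ₚ a ·ₚ q) +ₚ (0# ∷ p *ₚ q)       ≈⟨ +ₚ-assoc (b ·ₚ p) _ _ ⟩
      b ·ₚ p +ₚ (a ·ₚ q +ₚ (0# ∷ p *ₚ q))       ∎)

    *ₚ-comm : ∀ p q → p *ₚ q ≈ₚ q *ₚ p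
    *ₚ-comm []      q = ≈ₚ-sym (*ₚ-zeroʳ q)
    *ₚ-comm (a ∷ p) q =
      ≈ₚ-trans (+ₚ-cong ≈ₚ-refl (∷-cong refl (*ₚ-comm p q))) (≈ₚ-sym (*ₚ-∷ q a p))

    *ₚ-congʳ : ∀ {p p′} q → p ≈ₚ p′ → p *ₚ q ≈ₚ p′ *ₚ q
    *ₚ-congʳ {p} {p′} q p≈p′ =
      ≈ₚ-trans (*ₚ-comm p q) (≈ₚ-trans (*ₚ-congˡ q p≈p′) (*ₚ-comm q p′))

    *ₚ-distribʳ : ∀ r p q → (p +ₚ q) *ₚ r ≈ₚ p *ₚ r +ₚ q *ₚ r
    *ₚ-distribʳ r []      q       = ≈ₚ-refl
    *ₚ-distribʳ r (a ∷ p) []      = ≈ₚ-sym (+ₚ-identityʳ _)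
    *ₚ-distribʳ r (a ∷ p) (b ∷ q) = let open PS in begin
      (a + b) ·ₚ r +ₚ (0# ∷ (p +ₚ q) *ₚ r)
        ≈⟨ +ₚ-cong (·ₚ-distribʳ a b r) (∷-cong refl (*ₚ-distribʳ r p q)) ⟩
      (a ·ₚ r +ₚ b ·ₚ r) +ₚ (0# ∷ (p *ₚ r +ₚ q *ₚ r))
        ≈⟨ +ₚ-cong ≈ₚ-refl (0∷-+ (p *ₚ r) (q *ₚ r)) ⟩
      (a ·ₚ r +ₚ b ·ₚ r) +ₚ ((0# ∷ p *ₚ r) +ₚ (0# ∷ q *ₚ r))
        ≈⟨ +ₚ-interchange (a ·ₚ r) _ _ _ ⟩
      (a ·ₚ r +ₚ (0# ∷ p *ₚ r)) +ₚ (b ·ₚ r +ₚ (0# ∷ q *ₚ r)) ∎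

    *ₚ-distribˡ : ∀ p q r → p *ₚ (q +ₚ r) ≈ₚ p *ₚ q +ₚ p *ₚ r
    *ₚ-distribˡ p q r = ≈ₚ-trans (*ₚ-comm p (q +ₚ r))
      (≈ₚ-trans (*ₚ-distribʳ p q r) (+ₚ-cong (*ₚ-comm q p) (*ₚ-comm r p)))

    ·ₚ-*ₚ : ∀ a p q → (a ·ₚ p) *ₚ q ≈ₚ a ·ₚ (p *ₚ q)
    ·ₚ-*ₚ a []      q = ≈ₚ-refl
    ·ₚ-*ₚ a (b ∷ p) q = let open PS in begin
      (a * b) ·ₚ q +ₚ (0# ∷ (a ·ₚ p) *ₚ q)
        ≈⟨ +ₚ-cong (·ₚ-assoc a b q) (∷-cong (sym (zeroʳ a)) (·ₚ-*ₚ a p q)) ⟩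
      a ·ₚ b ·ₚ q +ₚ a ·ₚ (0# ∷ p *ₚ q)
        ≈⟨ ·ₚ-distribˡ a (b ·ₚ q) _ ⟨
      a ·ₚ (b ·ₚ q +ₚ (0# ∷ p *ₚ q)) ∎

    0∷-*ₚ : ∀ p q → (0# ∷ p) *ₚ q ≈ₚ 0# ∷ p *ₚ q
    0∷-*ₚ p q = +ₚ-cong (0·ₚ q) ≈ₚ-refl

    *ₚ-assoc : ∀ p q r → (p *ₚ q) *ₚ r ≈ₚ p *ₚ (q *ₚ r)
    *ₚ-assoc []      q r = ≈ₚ-refl
    *ₚ-assoc (a ∷ p) q r = let open PS in begin
      (a ·ₚ q +ₚ (0# ∷ p *ₚ q)) *ₚ r
        ≈⟨ *ₚ-distribʳ r (a ·ₚ q) (0# ∷ p *ₚ q) ⟩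
      (a ·ₚ q) *ₚ r +ₚ (0# ∷ p *ₚ q) *ₚ r
        ≈⟨ +ₚ-cong (·ₚ-*ₚ a q r) (0∷-*ₚ (p *ₚ q) r) ⟩
      a ·ₚ (q *ₚ r) +ₚ (0# ∷ (p *ₚ q) *ₚ r)
        ≈⟨ +ₚ-cong ≈ₚ-refl (∷-cong refl (*ₚ-assoc p q r)) ⟩
      a ·ₚ (q *ₚ r) +ₚ (0# ∷ p *ₚ (q *ₚ r)) ∎

    *ₚ-identityˡ : ∀ p → (1# ∷ []) *ₚ p ≈ₚ p
    *ₚ-identityˡ p = ≈ₚ-trans (+ₚ-cong (1·ₚ p) 0∷[]) (+ₚ-identityʳ p)

  +ₚ-*ₚ-isCommutativeRing : IsCommutativeRing _≈ₚ_ _+ₚ_ _*ₚ_ -ₚ_ [] (1# ∷ [])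
  +ₚ-*ₚ-isCommutativeRing = record
    { isRing = record
      { +-isAbelianGroup = record
        { isGroup = record
          { isMonoid = record
            { isSemigroup = record
              { isMagma = record
                { isEquivalence = Setoid.isEquivalence ≈ₚ-setoid
                ; ∙-cong        = +ₚ-cong
                }
              ; assoc = +ₚ-assoc
              }
            ; identity = (λ _ → ≈ₚ-refl) , +ₚ-identityʳ
            }
          ; inverse = -ₚ-inverseˡ , -ₚ-inverseʳ
          ; ⁻¹-cong = -ₚ-cong
          }
        ; comm = +ₚ-comm
        }
      ; *-cong     = λ {p} {p′} {q} {q′} p≈p′ q≈q′ →
                       ≈ₚ-trans (*ₚ-congʳ q p≈p′) (*ₚ-congˡ p′ q≈q′)
      ; *-assoc    = *ₚ-assoc
      ; *-identity = *ₚ-identityˡ ,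
                     λ p → ≈ₚ-trans (*ₚ-comm p (1# ∷ [])) (*ₚ-identityˡ p)
      ; distrib    = *ₚ-distribˡ , *ₚ-distribʳ
      }
    ; *-comm = *ₚ-comm
    }

  polynomialRing : CommutativeRing c ℓ
  polynomialRing = record { isCommutativeRing = +ₚ-*ₚ-isCommutativeRing }

-- A[x₁,…,xₙ], built one variable at a time.
infix 9 _[x₁⋯x_]

_[x₁⋯x_] : ∀ {c ℓ} → CommutativeRing c ℓ → ℕ → CommutativeRing c ℓ
A [x₁⋯x zero   ] = A
A [x₁⋯x sucℕ n ] = Univariate.polynomialRing (A [x₁⋯x n ])

infix 4 _≅_

_≅_ : ∀ {c ℓ} → CommutativeRing c ℓ → CommutativeRing c ℓ → Set (c ⊔ ℓ)
R ≅ S = ∃ (IsRingIsomorphism (CommutativeRing.rawRing R) (CommutativeRing.rawRing S))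

------------------------------------------------------------------------
-- Free and projective modules

module _ {c ℓ} {R : CommutativeRing c ℓ} where
  open CommutativeRing R using (Carrier; _≈_; 0#)

  module _ {m ℓm} (M : Module R m ℓm) where
    open Module M
    open RawMonoidSum +ᴹ-rawMonoid using (sum)

    linearCombination : ∀ {n} → Vector Carrier n → Vector Carrierᴹ n → Carrierᴹ
    linearCombination r x = sum (λ k → r k *ₗ x k)

    record IsBasis {i} {I : Set i} (b : I → Carrierᴹ) : Set (c ⊔ ℓ ⊔ m ⊔ ℓm ⊔ i) where
      field
        spanning : ∀ x → ∃ λ n → Σ (Vector Carrier n) λ r → Σ (Vector I n) λ k →
                   x ≈ᴹ linearCombination r (b ∘ k)
        linearlyIndependent :
          ∀ {n} (r : Vector Carrier n) (k : Vector I n) → Injective _≡_ _≡_ k →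
          linearCombination r (b ∘ k) ≈ᴹ 0ᴹ → ∀ j → r j ≈ 0#

    IsFree : Set (c ⊔ ℓ ⊔ suc m ⊔ ℓm)
    IsFree = Σ (Set m) λ I → Σ (I → Carrierᴹ) IsBasis

  IsLinear : ∀ {a ℓa b ℓb} (M : Module R a ℓa) (N : Module R b ℓb) →
             (Module.Carrierᴹ M → Module.Carrierᴹ N) → Set (c ⊔ a ⊔ ℓa ⊔ ℓb)
  IsLinear M N = ModuleMorphismStructures.ModuleMorphisms.IsModuleHomomorphism
                   (Module.rawModule M) (Module.rawModule N)

  -- The lifting property, tested against the modules of the given levels.
  IsProjective : ∀ {m ℓm} a ℓa → Module R m ℓm → Set (c ⊔ ℓ ⊔ m ⊔ ℓm ⊔ suc (a ⊔ ℓa))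
  IsProjective a ℓa P =
    (M N : Module R a ℓa) (let module M = Module M; module N = Module N; module P = Module P)
    (f : M.Carrierᴹ → N.Carrierᴹ) → IsLinear M N f → Surjective M._≈ᴹ_ N._≈ᴹ_ f →
    (g : P.Carrierᴹ → N.Carrierᴹ) → IsLinear P N g →
    Σ (P.Carrierᴹ → M.Carrierᴹ) λ h → IsLinear P M h × (∀ p → f (h p) N.≈ᴹ g p)

------------------------------------------------------------------------
-- Edge-labeled graphs and splines

-- The order in which `ends` lists the two endpoints of an edge is irrelevant
-- to splines, since ideals are closed under negation.  Loops and multiple
-- edges are allowed.

record EdgeLabeledGraph {c ℓ} (R : CommutativeRing c ℓ) : Set (suc (c ⊔ ℓ)) where
  field
    #vertices #edges : ℕ

  Vertex = Fin #vertices
  Edge   = Fin #edges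

  field
    ends : Edge → Vertex × Vertex
    α    : Edge → Ideal R

module _ {c ℓ} {R : CommutativeRing c ℓ} (G : EdgeLabeledGraph R) where
  open CommutativeRing R
  open EdgeLabeledGraph G

  record Spline : Set (c ⊔ ℓ) where
    field
      value    : Vertex → Carrier
      isSpline : ∀ e → let (u , v) = ends e in value u - value v ∈ members (α e)

  open Spline

  private
    open RingProperties ring using (-‿+-comm; -1*x≈-x; x[y-z]≈xy-xz)
    open CommutativeSemigroupProperties +-commutativeSemigroup using (interchange)
    open SetoidReasoning setoid
    module α e = Ideal (α e)

    +-difference : ∀ a b a′ b′ → (a - a′) + (b - b′) ≈ (a + b) - (a′ + b′)
    +-difference a b a′ b′ = trans (interchange a (- a′) b (- b′)) (+-congˡ (-‿+-comm a′ b′))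

    neg-difference : ∀ a a′ → - 1# * (a - a′) ≈ - a - - a′
    neg-difference a a′ = trans (-1*x≈-x (a - a′)) (sym (-‿+-comm a (- a′)))

    *-difference : ∀ a b a′ b′ → a * (b - b′) + b′ * (a - a′) ≈ a * b - a′ * b′
    *-difference a b a′ b′ = begin
      a * (b - b′) + b′ * (a - a′)                  ≈⟨ +-cong (x[y-z]≈xy-xz a b b′) (x[y-z]≈xy-xz b′ a a′) ⟩
      (a * b - a * b′) + (b′ * a - b′ * a′)         ≈⟨ +-congˡ (+-cong (*-comm b′ a) (-‿cong (*-comm b′ a′))) ⟩
      (a * b - a * b′) + (a * b′ - a′ * b′)         ≈⟨ +-assoc _ _ _ ⟩
      a * b + (- (a * b′) + (a * b′ - a′ * b′))     ≈⟨ +-congˡ (+-assoc _ _ _) ⟨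
      a * b + ((- (a * b′) + a * b′) - a′ * b′)     ≈⟨ +-congˡ (+-congʳ (-‿inverseˡ _)) ⟩
      a * b + (0# - a′ * b′)                        ≈⟨ +-congˡ (+-identityˡ _) ⟩
      a * b - a′ * b′                               ∎

  infix  4 _≈ˢ_
  infixl 6 _+ˢ_
  infixl 7 _*ˢ_
  infix  8 -ˢ_

  _≈ˢ_ : Spline → Spline → Set ℓ
  s ≈ˢ t = ∀ v → value s v ≈ value t v

  constant : Carrier → Spline
  constant r = record
    { value    = const r
    ; isSpline = λ e → α.resp-≈ e (sym (-‿inverseʳ r)) (α.0∈ e)
    }

  _+ˢ_ : Spline → Spline → Spline
  s +ˢ t = record
    { value    = λ v → value s v + value t v
    ; isSpline = λ e → α.resp-≈ e (+-difference _ _ _ _)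
                         (α.+-closed e (isSpline s e) (isSpline t e))
    }

  -ˢ_ : Spline → Spline
  -ˢ s = record
    { value    = λ v → - value s v
    ; isSpline = λ e → α.resp-≈ e (neg-difference _ _) (α.*-absorbs e (- 1#) (isSpline s e))
    }

  _*ˢ_ : Spline → Spline → Spline
  s *ˢ t = record
    { value    = λ v → value s v * value t v
    ; isSpline = λ e → α.resp-≈ e (*-difference _ _ _ _)
                         (α.+-closed e (α.*-absorbs e _ (isSpline t e))
                                       (α.*-absorbs e _ (isSpline s e)))
    }

  splineRing : CommutativeRing (c ⊔ ℓ) ℓ
  splineRing = record
    { Carrier = Spline
    ; _≈_     = _≈ˢ_
    ; _+_     = _+ˢ_
    ; _*_     = _*ˢ_
    ; -_      = -ˢ_
    ; 0#      = constant 0#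
    ; 1#      = constant 1#
    ; isCommutativeRing = record
      { isRing = record
        { +-isAbelianGroup = record
          { isGroup = record
            { isMonoid = record
              { isSemigroup = record
                { isMagma = record
                  { isEquivalence = record
                    { refl  = λ _ → refl
                    ; sym   = λ s≈t v → sym (s≈t v)
                    ; trans = λ s≈t t≈u v → trans (s≈t v) (t≈u v)
                    }
                  ; ∙-cong = λ s≈s′ t≈t′ v → +-cong (s≈s′ v) (t≈t′ v)
                  }
                ; assoc = λ _ _ _ _ → +-assoc _ _ _
                }
              ; identity = (λ _ _ → +-identityˡ _) , λ _ _ → +-identityʳ _
              }
            ; inverse = (λ _ _ → -‿inverseˡ _) , λ _ _ → -‿inverseʳ _
            ; ⁻¹-cong = λ s≈t v → -‿cong (s≈t v)
            }
          ; comm = λ _ _ _ → +-comm _ _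
          }
        ; *-cong     = λ s≈s′ t≈t′ v → *-cong (s≈s′ v) (t≈t′ v)
        ; *-assoc    = λ _ _ _ _ → *-assoc _ _ _
        ; *-identity = (λ _ _ → *-identityˡ _) , λ _ _ → *-identityʳ _
        ; distrib    = (λ _ _ _ _ → distribˡ _ _ _) , λ _ _ _ _ → distribʳ _ _ _
        }
      ; *-comm = λ _ _ _ → *-comm _ _
      }
    }

  splineModule : Module R (c ⊔ ℓ) ℓ
  splineModule = record
    { Carrierᴹ = Spline
    ; _≈ᴹ_     = _≈ˢ_
    ; _+ᴹ_     = _+ˢ_
    ; _*ₗ_     = λ r s → constant r *ˢ s
    ; _*ᵣ_     = λ s r → constant r *ˢ s
    ; 0ᴹ       = constant 0#
    ; -ᴹ_      = -ˢ_
    ; isModule = IsModuleFromLeft.isModule {commutativeRing = R} (record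
      { isLeftModule = record
        { isLeftSemimodule = record
          { +ᴹ-isCommutativeMonoid = CommutativeRing.+-isCommutativeMonoid splineRing
          ; isPreleftSemimodule    = record
            { *ₗ-cong      = λ r≈r′ s≈s′ v → *-cong r≈r′ (s≈s′ v)
            ; *ₗ-zeroˡ     = λ _ _ → zeroˡ _
            ; *ₗ-distribʳ  = λ _ _ _ _ → distribʳ _ _ _
            ; *ₗ-identityˡ = λ _ _ → *-identityˡ _
            ; *ₗ-assoc     = λ _ _ _ _ → *-assoc _ _ _
            ; *ₗ-zeroʳ     = λ _ _ → zeroʳ _
            ; *ₗ-distribˡ  = λ _ _ _ _ → distribˡ _ _ _
            }
          }
        ; -ᴹ‿cong    = λ s≈t v → -‿cong (s≈t v)
        ; -ᴹ‿inverse = (λ _ _ → -‿inverseˡ _) , λ _ _ → -‿inverseʳ _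
        }
      })
    }

-- Group the edges by label, with generators a₁,…,aₖ.  Splines are the vectors
-- s ∈ R^V with s v ≡ s (repᵢ v) mod aᵢ, where repᵢ v is a chosen vertex of the
-- component of v in the subgraph of edges labelled aᵢ.  Modulo aᵢ this becomes
-- "the coordinates at the non-representatives vanish" after subtracting s (repᵢ v)
-- from each s v, a product of elementary operations.  Since the aᵢ are pairwise
-- comaximal, the Chinese remainder theorem lifts these operations to a single
-- automorphism φ of R^V inducing the i-th one modulo each aᵢ; splines are then
-- characterised by divisibility conditions d v ∣ φ s v.  Hence the spline module
-- is isomorphic to ⨁ᵥ d v R, which over a domain is free on the v with d v ≠ 0;
-- no Quillen–Suslin theorem is needed for the polynomial rings.

{-# OPTIONS --safe #-}
module Submission where

open import Defs
open import Level using (Level; _⊔_; Lift; lift; lower)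
open import Algebra.Bundles using (CommutativeMonoid; CommutativeRing)
open import Algebra.Module.Bundles using (Module)
import Algebra.Module.Morphism.Structures as ModuleMorphismStructures
import Algebra.Module.Construct.TensorUnit as TensorUnit
import Algebra.Properties.CommutativeMonoid.Sum as Sum
import Algebra.Properties.CommutativeSemigroup as CommutativeSemigroupProperties
import Algebra.Properties.Group as GroupProperties
import Algebra.Properties.Ring as RingProperties
open import Axiom.ExcludedMiddle using (ExcludedMiddle)
open import Data.Fin.Base using (Fin; zero; suc; punchIn)
open import Data.Fin.Properties using (suc-injective; punchInᵢ≢i; _≟_)
open import Data.List.Base using (List; []; _∷_; foldr; allFin)
open import Data.List.Membership.Propositional.Properties using (∈-allFin)
open import Data.List.Relation.Unary.All as All using (All; []; _∷_)
open import Data.List.Relation.Unary.AllPairs.Core using (AllPairs; []; _∷_)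
open import Data.Nat.Base using (ℕ) renaming (zero to zeroℕ; suc to sucℕ)
open import Data.Product.Base using (Σ; ∃; _×_; _,_; proj₁; proj₂)
open import Data.Sum.Base using (_⊎_; inj₁; inj₂; [_,_]′)
open import Data.Vec.Functional using (Vector; removeAt)
open import Function.Base using (_∘_; id)
open import Function.Bundles using (_⇔_; mk⇔; Equivalence)
open import Function.Definitions using (Injective)
open import Relation.Binary.PropositionalEquality.Core as ≡ using (_≡_; _≢_)
import Relation.Binary.Construct.On as On
import Relation.Binary.Reasoning.Setoid as SetoidReasoning
open import Relation.Nullary.Decidable.Core using (Dec; yes; no; map′; ¬?; decidable-stable)
open import Relation.Nullary.Negation.Core using (¬_; contradiction)
open import Relation.Binary.Core using (Rel)
open import Relation.Binary.Structures using (IsEquivalence)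
open import Relation.Unary using (Pred; Decidable)

-- Finite sums and enumeration of decidable subsets.

module _ {a ℓ} (M : CommutativeMonoid a ℓ) where
  open CommutativeMonoid M
  open Sum M

  sum-zero : ∀ {n} (f : Vector Carrier n) → (∀ i → f i ≈ ε) → sum f ≈ ε
  sum-zero {n} f f≈ε = trans (sum-cong-≋ f≈ε) (sum-replicate-zero n)

  sum-single : ∀ {n} (f : Vector Carrier n) j → (∀ i → i ≢ j → f i ≈ ε) → sum f ≈ f j
  sum-single {sucℕ n} f j f≈ε = trans (sum-remove {i = j} f)
    (trans (∙-congˡ (sum-zero (removeAt f j) (λ i → f≈ε (punchIn j i) (punchInᵢ≢i j i)))) (identityʳ _))

  -- `sum-over` serves to discard from a linear combination the terms whose coefficient is known to
  -- vanish; `injective` gives the listing without repetition that linear independence requires.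
  record Enumeration {p n} (P : Pred (Fin n) p) : Set (a ⊔ ℓ ⊔ p) where
    field
      size      : ℕ
      element   : Fin size → Fin n
      injective : Injective _≡_ _≡_ element
      satisfies : ∀ i → P (element i)
      sum-over  : ∀ (f : Vector Carrier n) → (∀ i → ¬ P i → f i ≈ ε) → sum f ≈ sum (f ∘ element)

  enumerate : ∀ {p n} {P : Pred (Fin n) p} → Decidable P → Enumeration P
  enumerate {n = zeroℕ} P? = record
    { size = 0 ; element = λ () ; injective = λ { {()} } ; satisfies = λ () ; sum-over = λ _ _ → refl }
  enumerate {n = sucℕ n} {P} P? with P? zero | enumerate (P? ∘ suc)
  ... | yes p0 | E = record
    { size      = sucℕ E.size
    ; element   = λ { zero → zero ; (suc i) → suc (E.element i) }
    ; injective = λ { {zero} {zero} _ → ≡.refl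
                    ; {suc i} {suc j} eq → ≡.cong suc (E.injective (suc-injective eq)) }
    ; satisfies = λ { zero → p0 ; (suc i) → E.satisfies i }
    ; sum-over  = λ f f≈ε → ∙-congˡ (E.sum-over (f ∘ suc) (λ i → f≈ε (suc i)))
    }
    where
    module E = Enumeration E
  ... | no ¬p0 | E = record
    { size      = E.size
    ; element   = suc ∘ E.element
    ; injective = E.injective ∘ suc-injective
    ; satisfies = E.satisfies
    ; sum-over  = λ f f≈ε → trans (∙-cong (f≈ε zero ¬p0) (E.sum-over (f ∘ suc) (λ i → f≈ε (suc i)))) (identityˡ _)
    }
    where
    module E = Enumeration E

-- Linear maps and free modules

module _ {c ℓ} {R : CommutativeRing c ℓ} where
  open CommutativeRing R using (Carrier)

  module _ {a ℓa b ℓb} {M : Module R a ℓa} {N : Module R b ℓb} where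
    private
      module M = Module M
      module N = Module N
      module NG = GroupProperties N.+ᴹ-group

    -- Zero is preserved because it equals `0# *ₗ 0ᴹ`, negatives because of additivity, and the
    -- right action because it coincides with the left one.
    isLinear : (f : M.Carrierᴹ → N.Carrierᴹ) →
      (∀ {x y} → x M.≈ᴹ y → f x N.≈ᴹ f y) →
      (∀ x y → f (x M.+ᴹ y) N.≈ᴹ f x N.+ᴹ f y) →
      (∀ r x → f (r M.*ₗ x) N.≈ᴹ r N.*ₗ f x) →
      IsLinear M N f
    isLinear f f-cong f-+ f-* = record { isBimoduleHomomorphism = record
      { +ᴹ-isGroupHomomorphism = record
        { isMonoidHomomorphism = record
          { isMagmaHomomorphism = record
            { isRelHomomorphism = record { cong = f-cong }
            ; homo = f-+ }
          ; ε-homo = f-0 }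
        ; ⁻¹-homo = λ x → NG.inverseˡ-unique _ _
            (N.≈ᴹ-trans (N.≈ᴹ-sym (f-+ (M.-ᴹ x) x)) (N.≈ᴹ-trans (f-cong (M.-ᴹ‿inverseˡ x)) f-0)) }
      ; *ₗ-homo = f-*
      ; *ᵣ-homo = λ r x → N.≈ᴹ-trans (f-cong (M.≈ᴹ-sym (M.*ₗ-*ᵣ-coincident r x)))
          (N.≈ᴹ-trans (f-* r x) (N.*ₗ-*ᵣ-coincident r (f x)))
      } }
      where
      module R = CommutativeRing R
      f-0 : f M.0ᴹ N.≈ᴹ N.0ᴹ
      f-0 = N.≈ᴹ-trans (f-cong (M.≈ᴹ-sym (M.*ₗ-zeroˡ M.0ᴹ))) (N.≈ᴹ-trans (f-* R.0# M.0ᴹ) (N.*ₗ-zeroˡ _))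

    linear-combination : ∀ {f} → IsLinear M N f → ∀ {n} (r : Vector Carrier n) x →
      f (linearCombination M r x) N.≈ᴹ linearCombination N r (f ∘ x)
    linear-combination lin {zeroℕ}  r x = Lin.0ᴹ-homo
      where
      module Lin = ModuleMorphismStructures.ModuleMorphisms.IsModuleHomomorphism lin
    linear-combination {f} lin {sucℕ n} r x = N.≈ᴹ-trans (Lin.+ᴹ-homo _ _)
      (N.+ᴹ-cong (Lin.*ₗ-homo _ _) (linear-combination {f = f} lin (r ∘ suc) (x ∘ suc)))
      where
      module Lin = ModuleMorphismStructures.ModuleMorphisms.IsModuleHomomorphism lin

  IsFunctional : ∀ {m ℓm} (M : Module R m ℓm) → (Module.Carrierᴹ M → Carrier) → Set _
  IsFunctional M = IsLinear M (TensorUnit.⟨module⟩ {R = R})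

  module _ {m ℓm} {M : Module R m ℓm} where
    open Module M
    private
      module R = CommutativeRing R

    -- The sufficient half of the dual basis lemma: choose preimages under `f` of the finitely many
    -- `g (b i)` and extend them linearly with the coefficients `q i`.
    dualBasis⇒projective : ∀ {n} (b : Vector Carrierᴹ n) (q : Fin n → Carrierᴹ → Carrier) →
      (∀ i → IsFunctional M (q i)) → (∀ x → x ≈ᴹ linearCombination M (λ i → q i x) b) →
      ∀ a ℓa → IsProjective a ℓa M
    dualBasis⇒projective {n} b q q-lin expand a ℓa A B f f-lin f-surj g g-lin = h , h-lin , f∘h≈g
      where
      module A = Module A
      module B = Module B
      module SA = Sum A.+ᴹ-commutativeMonoid
      module q i = ModuleMorphismStructures.ModuleMorphisms.IsModuleHomomorphism (q-lin i)
      module g = ModuleMorphismStructures.ModuleMorphisms.IsModuleHomomorphism g-lin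
      y = λ i → proj₁ (f-surj (g (b i)))
      h : Carrierᴹ → A.Carrierᴹ
      h x = linearCombination A (λ i → q i x) y
      h-lin : IsLinear M A h
      h-lin = isLinear {M = M} {N = A} h
        (λ x≈x′ → SA.sum-cong-≋ {n} (λ i → A.*ₗ-cong (q.⟦⟧-cong i x≈x′) A.≈ᴹ-refl))
        (λ x x′ → A.≈ᴹ-trans
          (SA.sum-cong-≋ {n} (λ i → A.≈ᴹ-trans (A.*ₗ-cong (q.+ᴹ-homo i x x′) A.≈ᴹ-refl) (A.*ₗ-distribʳ _ _ _)))
          (SA.∑-distrib-+ {n} _ _))
        -- The scalar `r` is moved onto the vectors `y i`; linearity of scaling by `r` then takes it
        -- out of the whole combination.
        (λ r x → A.≈ᴹ-trans
          (SA.sum-cong-≋ {n} (λ i → A.≈ᴹ-trans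
            (A.*ₗ-cong (R.trans (q.*ₗ-homo i r x) (R.*-comm r _)) A.≈ᴹ-refl)
            (A.*ₗ-assoc _ _ _)))
          (A.≈ᴹ-sym (linear-combination {M = A} {N = A} (scaling r) (λ i → q i x) y)))
        where
        scaling : ∀ r → IsLinear A A (r A.*ₗ_)
        scaling r = isLinear {M = A} {N = A} (r A.*ₗ_) (A.*ₗ-cong R.refl) (A.*ₗ-distribˡ r)
          (λ s x → A.≈ᴹ-trans (A.≈ᴹ-sym (A.*ₗ-assoc r s x))
            (A.≈ᴹ-trans (A.*ₗ-cong (R.*-comm r s) A.≈ᴹ-refl) (A.*ₗ-assoc s r x)))
      f∘h≈g : ∀ x → f (h x) B.≈ᴹ g x
      f∘h≈g x = begin
        f (h x)                                   ≈⟨ linear-combination {M = A} {N = B} f-lin _ y ⟩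
        linearCombination B (λ i → q i x) (f ∘ y) ≈⟨ SB.sum-cong-≋ {n} (λ i →
                                                       B.*ₗ-cong R.refl (proj₂ (f-surj (g (b i))) A.≈ᴹ-refl)) ⟩
        linearCombination B (λ i → q i x) (g ∘ b) ≈⟨ linear-combination {M = M} {N = B} g-lin _ b ⟨
        g (linearCombination M (λ i → q i x) b)   ≈⟨ g.⟦⟧-cong (expand x) ⟨
        g x                                       ∎
        where
        open SetoidReasoning B.≈ᴹ-setoid
        module SB = Sum B.+ᴹ-commutativeMonoid

-- Modules with diagonal coordinates over an integral domain.

module _ {c ℓ} {R : CommutativeRing c ℓ} where
  open CommutativeRing R
  open import Algebra.Properties.Semiring.Divisibility semiring
  open SetoidReasoning setoid
  private
    module RP = RingProperties ring

  *-cancelʳ-nonZero : IsIntegralDomain R → ∀ {x y d} → ¬ (d ≈ 0#) → x * d ≈ y * d → x ≈ y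
  *-cancelʳ-nonZero (_ , domain) {x} {y} {d} d≉0 xd≈yd =
    [ RP.x∙y⁻¹≈ε⇒x≈y x y , (λ d≈0 → contradiction d≈0 d≉0) ]′
      (domain (x - y) d (trans (RP.[y-z]x≈yx-zx d x y) (RP.x≈y⇒x∙y⁻¹≈ε xd≈yd)))

  -- An isomorphism of M with ⨁ᵢ d i R inside Rⁿ.
  record DiagonalCoordinates {m ℓm} (M : Module R m ℓm) (n : ℕ) : Set (c ⊔ ℓ ⊔ m ⊔ ℓm) where
    open Module M
    field
      coordinate   : Fin n → Carrierᴹ → Carrier
      isFunctional : ∀ i → IsFunctional M (coordinate i)
      injective    : ∀ {x y} → (∀ i → coordinate i x ≈ coordinate i y) → x ≈ᴹ y
      d            : Fin n → Carrier
      d∣coordinate : ∀ i x → d i ∣ coordinate i x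
      basis        : Fin n → Carrierᴹ
      diagonal     : ∀ i → coordinate i (basis i) ≈ d i
      off-diagonal : ∀ {i j} → j ≢ i → coordinate i (basis j) ≈ 0#

    -- Since `j` is injective, every term other than the one at `l` involves a basis vector whose
    -- `i`-th coordinate is zero.
    coordinate-combination : ∀ i {k} (r : Vector Carrier k) (j : Vector (Fin n) k) l → j l ≡ i →
      Injective _≡_ _≡_ j → coordinate i (linearCombination M r (basis ∘ j)) ≈ r l * d i
    coordinate-combination i r j l ≡.refl j-inj = begin
      coordinate i (linearCombination M r (basis ∘ j))
        ≈⟨ linear-combination {M = M} {N = TensorUnit.⟨module⟩} (isFunctional i) r (basis ∘ j) ⟩
      linearCombination (TensorUnit.⟨module⟩ {R = R}) r (coordinate i ∘ basis ∘ j)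
        ≈⟨ sum-single +-commutativeMonoid (λ k → r k * coordinate i (basis (j k))) l (λ k k≢l →
             trans (*-congˡ (off-diagonal (k≢l ∘ j-inj))) (zeroʳ _)) ⟩
      r l * coordinate i (basis i)
        ≈⟨ *-congˡ (diagonal i) ⟩
      r l * d i ∎

  module _ (R-domain : IsIntegralDomain R) (0? : ∀ x → Dec (x ≈ 0#))
           {m ℓm} {M : Module R m ℓm} {n} (D : DiagonalCoordinates M n) where
    open Module M
    open DiagonalCoordinates D

    private
      -- The coefficient of `basis i` in `x`. If `d i ≈ 0`, every element is a divisibility witness,
      -- so the one supplied carries no information.
      quotient : Fin n → Carrierᴹ → Carrier
      quotient i x with 0? (d i) | d∣coordinate i x
      ... | yes _ | _     = 0#
      ... | no  _ | q , _ = q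

      quotient-zero : ∀ i x → d i ≈ 0# → quotient i x ≈ 0#
      quotient-zero i x d≈0 with 0? (d i)
      ... | yes _   = refl
      ... | no  d≉0 = contradiction d≈0 d≉0

      quotient-* : ∀ i x → quotient i x * d i ≈ coordinate i x
      quotient-* i x with 0? (d i) | d∣coordinate i x
      ... | yes d≈0 | q , qd≈ = trans (zeroˡ _) (trans (sym (trans (*-congˡ d≈0) (zeroʳ q))) qd≈)
      ... | no  _   | _ , qd≈ = qd≈

      -- The junk value 0 of the quotient by 0 keeps it linear.
      quotient-unique : ∀ i x y → (d i ≈ 0# → y ≈ 0#) → coordinate i x ≈ y * d i → quotient i x ≈ y
      quotient-unique i x y y≈0 eq with 0? (d i)
      ... | yes d≈0 = sym (y≈0 d≈0)
      ... | no  d≉0 with d∣coordinate i x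
      ...   | q , qd≈ = *-cancelʳ-nonZero R-domain d≉0 (trans qd≈ eq)

      quotient-isFunctional : ∀ i → IsFunctional M (quotient i)
      quotient-isFunctional i = isLinear {M = M} {N = TensorUnit.⟨module⟩} (quotient i)
        (λ {x} {y} x≈y → quotient-unique i x _ (quotient-zero i y)
          (trans (⟦⟧-cong x≈y) (sym (quotient-* i y))))
        (λ x y → quotient-unique i _ _
          (λ d≈0 → trans (+-cong (quotient-zero i x d≈0) (quotient-zero i y d≈0)) (+-identityˡ 0#))
          (trans (+ᴹ-homo x y) (trans (sym (+-cong (quotient-* i x) (quotient-* i y))) (sym (distribʳ _ _ _)))))
        (λ r x → quotient-unique i _ _
          (λ d≈0 → trans (*-congˡ (quotient-zero i x d≈0)) (zeroʳ r))
          (trans (*ₗ-homo r x) (trans (sym (*-congˡ (quotient-* i x))) (sym (*-assoc _ _ _)))))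
        where
        open ModuleMorphismStructures.ModuleMorphisms.IsModuleHomomorphism (isFunctional i)
          using (⟦⟧-cong; +ᴹ-homo; *ₗ-homo)

      -- Coordinates are jointly injective, and the `i`-th coordinate of either side is
      -- `quotient i x * d i`.
      expansion : ∀ x → x ≈ᴹ linearCombination M (λ i → quotient i x) basis
      expansion x = injective λ i → sym (trans (coordinate-combination i _ id i ≡.refl id) (quotient-* i x))

    diagonal⇒projective : ∀ a ℓa → IsProjective a ℓa M
    diagonal⇒projective = dualBasis⇒projective {M = M} basis quotient quotient-isFunctional expansion

    -- The `basis i` with `d i` nonzero suffice: the others have coefficient zero in every
    -- expansion. In a vanishing combination, taking a coordinate gives a product of a coefficient
    -- with a nonzero `d i`, so the coefficient vanishes in a domain.
    diagonal⇒free : IsFree M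
    diagonal⇒free = Lift _ (Fin E.size) , basis ∘ E.element ∘ lower , record
      { spanning = λ x → E.size , (λ i → quotient (E.element i) x) , lift ,
          ≈ᴹ-trans (expansion x) (E.sum-over _ (λ i ¬d≉0 →
            ≈ᴹ-trans (*ₗ-cong (quotient-zero i x (d-zero i ¬d≉0)) ≈ᴹ-refl) (*ₗ-zeroˡ _)))
      ; linearlyIndependent = λ r k k-inj combination≈0 j →
          let open ModuleMorphismStructures.ModuleMorphisms.IsModuleHomomorphism
                     (isFunctional (E.element (lower (k j)))) using (⟦⟧-cong; 0ᴹ-homo)
          in [ id , (λ d≈0 → contradiction d≈0 (E.satisfies (lower (k j)))) ]′
            (proj₂ R-domain _ _ (trans
              (sym (coordinate-combination _ r (E.element ∘ lower ∘ k) j ≡.refl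
                (k-inj ∘ ≡.cong lift ∘ E.injective)))
              (trans (⟦⟧-cong combination≈0) 0ᴹ-homo)))
      }
      where
      module E = Enumeration (enumerate +ᴹ-commutativeMonoid {P = λ i → ¬ (d i ≈ 0#)} (λ i → ¬? (0? (d i))))
      d-zero : ∀ i → ¬ ¬ (d i ≈ 0#) → d i ≈ 0#
      d-zero i = decidable-stable (0? (d i))

-- Merging two classes of a partition

module _ {n} (rep : Fin n → Fin n) (u v : Fin n) where

  merge : Fin n → Fin n
  merge w with rep w ≟ rep v
  ... | yes _ = rep u
  ... | no  _ = rep w

  merge-idem : (∀ w → rep (rep w) ≡ rep w) → ∀ w → merge (merge w) ≡ merge w
  merge-idem idem w with rep w ≟ rep v
  ... | yes _ with rep (rep u) ≟ rep v
  ...   | yes _ = ≡.refl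
  ...   | no  _ = idem u
  merge-idem idem w | no w≢v with rep (rep w) ≟ rep v
  ...   | yes w≡v = contradiction (≡.trans (≡.sym (idem w)) w≡v) w≢v
  ...   | no  _   = idem w

  module _ {r} {_~_ : Rel (Fin n) r} (~-equiv : IsEquivalence _~_) where
    private
      module ~ = IsEquivalence ~-equiv

    -- With `merge-joins` and `merge-refines` this shows that agreement with the merged
    -- representatives amounts to agreement with the old ones together with `u ~ v`. In the absorbed
    -- class the chain is `w`, `rep v`, `v`, `u`, `rep u`.
    merge-sound : u ~ v → (∀ w → w ~ rep w) → ∀ w → w ~ merge w
    merge-sound u~v r~ w with rep w ≟ rep v
    ... | no  _   = r~ w
    ... | yes w≡v = ~.trans (r~ w) (~.trans (~.reflexive w≡v)
                      (~.trans (~.sym (r~ v)) (~.trans (~.sym u~v) (r~ u))))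

    private
      merge-u : merge u ≡ rep u
      merge-u with rep u ≟ rep v
      ... | yes _ = ≡.refl
      ... | no  _ = ≡.refl

      merge-class : ∀ w → rep w ≡ rep v → merge w ≡ rep u
      merge-class w w≡v with rep w ≟ rep v
      ... | yes _   = ≡.refl
      ... | no  w≢v = contradiction w≡v w≢v

      ~rep-u : (∀ w → w ~ merge w) → ∀ w → rep w ≡ rep v → w ~ rep u
      ~rep-u m~ w w≡v = ~.trans (m~ w) (~.reflexive (merge-class w w≡v))

    -- Both `u` and `v` have `rep u` as merged representative.
    merge-joins : (∀ w → w ~ merge w) → u ~ v
    merge-joins m~ = ~.trans (m~ u) (~.trans (~.reflexive merge-u) (~.sym (~rep-u m~ v ≡.refl)))

    -- In the absorbed class, idempotence puts `rep w` into the class of `w`, so both are related to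
    -- `rep u`.
    merge-refines : (∀ w → rep (rep w) ≡ rep w) → (∀ w → w ~ merge w) → ∀ w → w ~ rep w
    merge-refines idem m~ w with rep w ≟ rep v | m~ w
    ... | no  _   | w~ = w~
    ... | yes w≡v | w~ = ~.trans w~ (~.sym (~rep-u m~ (rep w) (≡.trans (idem w) w≡v)))

-- Congruences and comaximal elements.

module _ {c ℓ} (R : CommutativeRing c ℓ) where
  open CommutativeRing R
  open import Algebra.Properties.Semiring.Divisibility semiring
  open import Algebra.Properties.CommutativeSemigroup.Divisibility *-commutativeSemigroup
    using (x∣xy; ∙-cong-∣)
  open SetoidReasoning setoid
  private
    module RP = RingProperties ring

  ∣-+ : ∀ {a x y} → a ∣ x → a ∣ y → a ∣ x + y
  ∣-+ (p , pa≈x) (q , qa≈y) = p + q , trans (distribʳ _ p q) (+-cong pa≈x qa≈y)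

  ∣-neg : ∀ {a x} → a ∣ x → a ∣ - x
  ∣-neg (p , pa≈x) = - p , trans (sym (RP.-‿distribˡ-* p _)) (-‿cong pa≈x)

  ∣-*ʳ : ∀ {a x} → a ∣ x → ∀ y → a ∣ x * y
  ∣-*ʳ a∣x y = ∣ʳ-respʳ-≈ (*-comm y _) (x∣ʳy⇒x∣ʳzy y a∣x)

  ≡mod-isEquivalence : ∀ a → IsEquivalence (λ x y → a ∣ x - y)
  ≡mod-isEquivalence a = record
    { refl  = λ {x} → ∣ʳ-respʳ-≈ (sym (-‿inverseʳ x)) (a ∣0)
    ; sym   = λ {x} {y} a∣ → ∣ʳ-respʳ-≈ (RP.⁻¹-anti-homo‿- x y) (∣-neg a∣)
    ; trans = λ {x} {y} {z} p q → ∣ʳ-respʳ-≈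
        (trans (sym (+-assoc _ y (- z))) (+-congʳ (RP.//-rightDividesˡ y x))) (∣-+ p q)
    }

  ∣-resp-≡mod : ∀ {a x y} → a ∣ x - y → a ∣ y → a ∣ x
  ∣-resp-≡mod {y = y} a∣ a∣y = ∣ʳ-respʳ-≈ (RP.//-rightDividesˡ y _) (∣-+ a∣ a∣y)

  ∣-resp-≡mod˘ : ∀ {a x y} → a ∣ x - y → a ∣ x → a ∣ y
  ∣-resp-≡mod˘ {a} a∣ = ∣-resp-≡mod (IsEquivalence.sym (≡mod-isEquivalence a) a∣)

  -‿interchange : ∀ x y z w → (x - y) - (z - w) ≈ (x - z) - (y - w)
  -‿interchange x y z w = begin
    (x - y) - (z - w)        ≈⟨ +-congˡ (RP.-‿+-comm z (- w)) ⟨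
    (x - y) + (- z - - w)    ≈⟨ interchange x (- y) (- z) (- - w) ⟩
    (x - z) + (- y - - w)    ≈⟨ +-congˡ (RP.-‿+-comm y (- w)) ⟩
    (x - z) - (y - w)        ∎
    where
    open CommutativeSemigroupProperties +-commutativeSemigroup using (interchange)

  -- The witness is the solution of ε ≡ 1 mod a, ε ≡ 0 mod b.
  Comaximal : Carrier → Carrier → Set (c ⊔ ℓ)
  Comaximal a b = ∃ λ ε → a ∣ 1# - ε × b ∣ ε

  private
    1-[1-x] : ∀ x → 1# - (1# - x) ≈ x
    1-[1-x] x = begin
      1# - (1# - x)   ≈⟨ +-congˡ (RP.⁻¹-anti-homo‿- 1# x) ⟩
      1# + (x - 1#)   ≈⟨ +-comm _ _ ⟩
      (x - 1#) + 1#   ≈⟨ RP.//-rightDividesˡ 1# x ⟩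
      x               ∎

  -- Passing from `ε` to `1# - ε` exchanges the residues 0 and 1.
  comaximal-sym : ∀ {a b} → Comaximal a b → Comaximal b a
  comaximal-sym (ε , a∣ , b∣) = 1# - ε , ∣ʳ-respʳ-≈ (sym (1-[1-x] ε)) b∣ , a∣

  comaximal-1 : ∀ a → Comaximal a 1#
  comaximal-1 a = 1# , ∣ʳ-respʳ-≈ (sym (-‿inverseʳ 1#)) (a ∣0) , 1∣ 1#

  -- The witnesses multiply, since `1# - ε * δ` is the sum of `1# - ε` and `ε * (1# - δ)`.
  comaximal-* : ∀ {a b c} → Comaximal a b → Comaximal a c → Comaximal a (b * c)
  comaximal-* {a} (ε , a∣1-ε , b∣ε) (δ , a∣1-δ , c∣δ) = ε * δ ,
    IsEquivalence.trans (≡mod-isEquivalence a) a∣1-ε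
      (∣ʳ-respʳ-≈ (trans (RP.x[y-z]≈xy-xz ε 1# δ) (+-congʳ (*-identityʳ ε))) (x∣ʳy⇒x∣ʳzy ε a∣1-δ)) ,
    ∙-cong-∣ b∣ε c∣δ

  comaximal-∣ : ∀ {a b d} → d ∣ b → Comaximal a b → Comaximal a d
  comaximal-∣ d∣b (ε , a∣ , b∣) = ε , a∣ , ∣ʳ-trans d∣b b∣

  -- Split `x` as `(1# - ε) * x + x * ε`: in the first term `a` divides `1# - ε` and `b` divides
  -- `x`, in the second `a` divides `x` and `b` divides `ε`.
  comaximal-*-∣ : ∀ {a b x} → Comaximal a b → a ∣ x → b ∣ x → a * b ∣ x
  comaximal-*-∣ {a} {b} {x} (ε , a∣1-ε , b∣ε) a∣x b∣x = ∣ʳ-respʳ-≈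
    (begin
      (1# - ε) * x + x * ε  ≈⟨ +-congˡ (*-comm x ε) ⟩
      (1# - ε) * x + ε * x  ≈⟨ distribʳ x _ ε ⟨
      ((1# - ε) + ε) * x    ≈⟨ *-congʳ (RP.//-rightDividesˡ ε 1#) ⟩
      1# * x                ≈⟨ *-identityˡ x ⟩
      x                     ∎)
    (∣-+ (∙-cong-∣ a∣1-ε b∣x) (∙-cong-∣ a∣x b∣ε))

  -- Linear automorphisms of Rⁿ and shears.

  record Automorphism (n : ℕ) : Set (c ⊔ ℓ) where
    field
      to from   : Vector Carrier n → Vector Carrier n
      to-cong   : ∀ {s t} → (∀ v → s v ≈ t v) → ∀ v → to s v ≈ to t v
      from-cong : ∀ {s t} → (∀ v → s v ≈ t v) → ∀ v → from s v ≈ from t v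
      to-+      : ∀ s t v → to (λ w → s w + t w) v ≈ to s v + to t v
      to-*      : ∀ r s v → to (λ w → r * s w) v ≈ r * to s v
      from∘to   : ∀ s v → from (to s) v ≈ s v
      to∘from   : ∀ s v → to (from s) v ≈ s v

  identity : ∀ n → Automorphism n
  identity n = record
    { to = id ; from = id ; to-cong = id ; from-cong = id
    ; to-+ = λ _ _ _ → refl ; to-* = λ _ _ _ → refl
    ; from∘to = λ _ _ → refl ; to∘from = λ _ _ → refl }

  infixr 9 _⊙_

  _⊙_ : ∀ {n} → Automorphism n → Automorphism n → Automorphism n
  ψ ⊙ φ = record
    { to        = ψ.to ∘ φ.to
    ; from      = φ.from ∘ ψ.from
    ; to-cong   = ψ.to-cong ∘ φ.to-cong
    ; from-cong = φ.from-cong ∘ ψ.from-cong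
    ; to-+      = λ s t v → trans (ψ.to-cong (φ.to-+ s t) v) (ψ.to-+ _ _ v)
    ; to-*      = λ r s v → trans (ψ.to-cong (φ.to-* r s) v) (ψ.to-* _ _ v)
    ; from∘to   = λ s v → trans (φ.from-cong (ψ.from∘to (φ.to s)) v) (φ.from∘to s v)
    ; to∘from   = λ s v → trans (ψ.to-cong (φ.to∘from (ψ.from s)) v) (ψ.to∘from s v)
    }
    where
    module φ = Automorphism φ
    module ψ = Automorphism ψ

  module _ {n} (rep : Fin n → Fin n) where

    shear : (Fin n → Carrier) → Vector Carrier n → Vector Carrier n
    shear μ s v = s v + μ v * s (rep v)

    -- As `μ` vanishes at representatives, the first shear leaves unchanged the entries that the
    -- second one reads, so the coefficients simply add.
    shear-cancel : ∀ {μ ν} → (∀ v → μ v + ν v ≈ 0#) → (∀ v → μ (rep v) ≈ 0#) →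
                   ∀ s v → shear ν (shear μ s) v ≈ s v
    shear-cancel {μ} {ν} μ+ν≈0 μ-rep s v = begin
      (s v + μ v * s w) + ν v * (s w + μ w * s (rep w))
        ≈⟨ +-congˡ (*-congˡ (trans (+-congˡ (trans (*-congʳ (μ-rep v)) (zeroˡ _))) (+-identityʳ _))) ⟩
      (s v + μ v * s w) + ν v * s w   ≈⟨ +-assoc _ _ _ ⟩
      s v + (μ v * s w + ν v * s w)   ≈⟨ +-congˡ (distribʳ _ _ _) ⟨
      s v + (μ v + ν v) * s w         ≈⟨ +-congˡ (trans (*-congʳ (μ+ν≈0 v)) (zeroˡ _)) ⟩
      s v + 0#                        ≈⟨ +-identityʳ _ ⟩
      s v                             ∎
      where w = rep v

    shear-automorphism : ∀ μ → (∀ v → μ (rep v) ≈ 0#) → Automorphism n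
    shear-automorphism μ μ-rep = record
      { to        = shear μ
      ; from      = shear (-_ ∘ μ)
      ; to-cong   = cong μ
      ; from-cong = cong (-_ ∘ μ)
      ; to-+      = λ s t v → trans (+-congˡ (distribˡ _ _ _)) (interchange _ _ _ _)
      ; to-*      = λ r s v → trans (+-congˡ (x∙yz≈y∙xz _ _ _)) (sym (distribˡ r _ _))
      ; from∘to   = shear-cancel (λ v → -‿inverseʳ (μ v)) μ-rep
      ; to∘from   = shear-cancel (λ v → -‿inverseˡ (μ v)) (λ v → trans (-‿cong (μ-rep v)) RP.-0#≈0#)
      }
      where
      open CommutativeSemigroupProperties +-commutativeSemigroup using (interchange)
      open CommutativeSemigroupProperties *-commutativeSemigroup using (x∙yz≈y∙xz)
      cong : ∀ μ {s t} → (∀ v → s v ≈ t v) → ∀ v → shear μ s v ≈ shear μ t v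
      cong μ s≈t v = +-cong (s≈t v) (*-congˡ (s≈t (rep v)))

  -- Systems of congruences s v ≡ s (rep v)

  module _ {E : Set} (label : E → Carrier) (n : ℕ) where

    -- A partition is encoded by an idempotent choice of representatives. The modulus is kept as an
    -- index, so that labels can later be compared through their edges.
    record Constraint : Set where
      field
        index : E
        rep   : Fin n → Fin n
        idem  : ∀ v → rep (rep v) ≡ rep v

      modulus : Carrier
      modulus = label index

      Satisfied : Vector Carrier n → Set (c ⊔ ℓ)
      Satisfied s = ∀ v → modulus ∣ s v - s (rep v)

    open Constraint

    modulusProduct : List Constraint → Carrier
    modulusProduct = foldr (λ C → modulus C *_) 1#

    comaximal-product : ∀ {a L} → All (λ C → Comaximal a (modulus C)) L → Comaximal a (modulusProduct L)
    comaximal-product []       = comaximal-1 _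
    comaximal-product (p ∷ ps) = comaximal-* p (comaximal-product ps)

    -- In other words, `φ` carries the solutions of `P` onto ⨁ᵥ d v R.
    record Diagonalisation (P : Pred (Vector Carrier n) (c ⊔ ℓ)) : Set (c ⊔ ℓ) where
      field
        φ        : Automorphism n
        d        : Fin n → Carrier
        sound    : ∀ s → P s → ∀ v → d v ∣ Automorphism.to φ s v
        complete : ∀ s → (∀ v → d v ∣ Automorphism.to φ s v) → P s

    -- The extra modulus b, comaximal with all the others, is what lets the induction
    -- compose automorphisms: each factor must not disturb the remaining moduli.
    diagonalise-mod : ∀ L → AllPairs (λ C D → Comaximal (modulus C) (modulus D)) L →
      ∀ b → All (λ C → Comaximal b (modulus C)) L →
      Σ (Diagonalisation (λ s → All (λ C → Satisfied C s) L)) λ Δ → let open Diagonalisation Δ in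
      (∀ s v → b ∣ Automorphism.to φ s v - s v) × (∀ v → d v ∣ modulusProduct L)
    diagonalise-mod [] _ b _ = record
      { φ = identity n ; d = λ _ → 1# ; sound = λ _ _ _ → 1∣ _ ; complete = λ _ _ → [] } ,
      (λ _ _ → IsEquivalence.refl (≡mod-isEquivalence b)) , λ _ → ∣ʳ-refl
    diagonalise-mod (C ∷ L) (C#L ∷ L#L) b (b#C ∷ b#L) with
      -- With `modulus C * b` as extra modulus, the recursive `φ` is the identity modulo both
      -- factors. The second value is the Chinese remainder element `ε`: 1 modulo `modulus C`, 0
      -- modulo `b` times the product of the later moduli.
      diagonalise-mod L L#L (modulus C * b)
        (All.map (λ (p , q) → comaximal-sym (comaximal-* (comaximal-sym p) (comaximal-sym q))) (All.zip (C#L , b#L)))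
      | comaximal-* (comaximal-sym b#C) (comaximal-product C#L)
    ... | Δ , φ≡id , d∣c | ε , a∣1-ε , bc∣ε = record
      { φ = shear-automorphism r μ μ-rep ⊙ φ
      ; d = d′
      ; sound = λ { s (sC ∷ sL) → sound′ s sC (sound s sL) }
      ; complete = λ s d′∣ → complete-C s d′∣ ∷ complete s (complete-L s d′∣)
      } , ≡mod-b , d′∣ac
      where
      open Diagonalisation Δ
      r = rep C
      a = modulus C
      c′ = modulusProduct L
      φs = Automorphism.to φ

      -- Modulo `a` this coefficient is -1 at non-representatives, so the shear subtracts the entry
      -- at the representative; modulo `b * c′` it is 0 everywhere.
      μ : Fin n → Carrier
      μ v with r v ≟ v
      ... | yes _ = 0#
      ... | no  _ = - ε

      d′ : Fin n → Carrier
      d′ v with r v ≟ v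
      ... | yes _ = d v
      ... | no  _ = a * d v

      μ-rep : ∀ v → μ (r v) ≈ 0#
      μ-rep v with r (r v) ≟ r v
      ... | yes _ = refl
      ... | no  ¬p = contradiction (idem C v) ¬p

      ψ : Vector Carrier n → Vector Carrier n
      ψ s = shear r μ (φs s)

      ∣μ : ∀ {x} → x ∣ b * c′ → ∀ v → x ∣ μ v
      ∣μ {x} x∣bc v with r v ≟ v
      ... | yes _ = x ∣0
      ... | no  _ = ∣-neg (∣ʳ-trans x∣bc bc∣ε)

      -- The shear adds a multiple of `μ v`. This is used for `b` and for each `d v`, which divides
      -- `c′`.
      ψ≡φ : ∀ {x} → x ∣ b * c′ → ∀ s v → x ∣ ψ s v - φs s v
      ψ≡φ x∣bc s v = ∣ʳ-respʳ-≈ (sym (RP.xyx⁻¹≈y _ _)) (∣-*ʳ (∣μ x∣bc v) _)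

      d∣bc : ∀ v → d v ∣ b * c′
      d∣bc v = x∣ʳy⇒x∣ʳzy b (d∣c v)

      ≡mod-b : ∀ s v → b ∣ ψ s v - s v
      ≡mod-b s v = IsEquivalence.trans (≡mod-isEquivalence b)
        (ψ≡φ (x∣xy b c′) s v) (∣ʳ-trans (x∣ʳyx b a) (φ≡id s v))

      d′∣ac : ∀ v → d′ v ∣ a * c′
      d′∣ac v with r v ≟ v
      ... | yes _ = x∣ʳy⇒x∣ʳzy a (d∣c v)
      ... | no  _ = ∙-cong-∣ ∣ʳ-refl (d∣c v)

      d∣d′ : ∀ v → d v ∣ d′ v
      d∣d′ v with r v ≟ v
      ... | yes _ = ∣ʳ-refl
      ... | no  _ = x∣ʳyx (d v) a

      complete-L : ∀ s → (∀ v → d′ v ∣ ψ s v) → ∀ v → d v ∣ φs s v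
      complete-L s d′∣ v = ∣-resp-≡mod˘ (ψ≡φ (d∣bc v) s v) (∣ʳ-trans (d∣d′ v) (d′∣ v))

      φ≡id-a : ∀ s v → a ∣ φs s v - s v
      φ≡id-a s v = ∣ʳ-trans (x∣xy a b) (φ≡id s v)

      -- Modulo `a`, `φ` is the identity and `ε` is 1.
      ψ≡difference : ∀ s v → r v ≢ v → a ∣ ψ s v - (s v - s (r v))
      ψ≡difference s v rv≢v with r v ≟ v
      ... | yes rv≡v = contradiction rv≡v rv≢v
      ... | no  _    = ∣ʳ-respʳ-≈ (trans (-‿interchange _ _ _ _) (+-congʳ (+-congˡ (RP.-‿distribˡ-* ε _))))
        (∣-+ (φ≡id-a s v) (∣-neg (≡a.trans ε-≡ (φ≡id-a s (r v)))))
        where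
        module ≡a = IsEquivalence (≡mod-isEquivalence a)
        ε-≡ : ∀ {x} → a ∣ ε * x - x
        ε-≡ {x} = ≡a.sym (∣ʳ-respʳ-≈ (trans (RP.[y-z]x≈yx-zx x 1# ε) (+-congʳ (*-identityˡ x))) (∣-*ʳ a∣1-ε x))

      -- At a non-representative, `a` divides by the constraint `C` and `d v` by the induction;
      -- being comaximal, they divide jointly.
      sound′ : ∀ s → Satisfied C s → (∀ v → d v ∣ φs s v) → ∀ v → d′ v ∣ ψ s v
      sound′ s sC d∣ v with r v ≟ v | ∣-resp-≡mod (ψ≡φ (d∣bc v) s v) (d∣ v) | ψ≡difference s v
      ... | yes _    | d∣ψ | _    = d∣ψ
      ... | no  rv≢v | d∣ψ | ψ≡ = comaximal-*-∣
        (comaximal-∣ (d∣c v) (comaximal-product C#L)) (∣-resp-≡mod (ψ≡ rv≢v) (sC v)) d∣ψ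

      complete-C : ∀ s → (∀ v → d′ v ∣ ψ s v) → Satisfied C s
      complete-C s d′∣ v with r v ≟ v | d′∣ v | ψ≡difference s v
      ... | yes rv≡v | _     | _  = IsEquivalence.reflexive (≡mod-isEquivalence a) (≡.cong s (≡.sym rv≡v))
      ... | no  rv≢v | ad∣ψ | ψ≡ = ∣-resp-≡mod˘ (ψ≡ rv≢v) (∣ʳ-trans (x∣xy a (d v)) ad∣ψ)

    -- The induction starts from the modulus `1#`, which is comaximal with every element.
    diagonalise : ∀ L → AllPairs (λ C D → Comaximal (modulus C) (modulus D)) L →
      Diagonalisation (λ s → All (λ C → Satisfied C s) L)
    diagonalise L L#L = proj₁ (diagonalise-mod L L#L 1# (All.universal (λ C → comaximal-sym (comaximal-1 _)) L))

    -- Grouping the edges by label.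

    module _ (ends : E → Fin n × Fin n)
             (compare : ∀ e f → (label e ∥ label f) ⊎ Comaximal (label e) (label f)) where

      EdgeSatisfied : Vector Carrier n → E → Set (c ⊔ ℓ)
      EdgeSatisfied s e = label e ∣ s (proj₁ (ends e)) - s (proj₂ (ends e))

      private
        module Merge (f : E) (r : Fin n → Fin n) (s : Vector Carrier n) (e : E) where
          equiv : IsEquivalence (λ v w → label f ∣ s v - s w)
          equiv = On.isEquivalence s (≡mod-isEquivalence (label f))

          u = proj₁ (ends e)
          v = proj₂ (ends e)

          open IsEquivalence equiv public using () renaming (refl to ~-refl)
          sound   = merge-sound r u v equiv
          joins   = merge-joins r u v equiv
          refines = merge-refines r u v equiv

      mergeEdge : E → Constraint → Constraint
      mergeEdge e C = record
        { index = index C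
        ; rep   = merge (rep C) (proj₁ (ends e)) (proj₂ (ends e))
        ; idem  = merge-idem (rep C) _ _ (idem C) }

      edgeConstraint : E → Constraint
      edgeConstraint e = mergeEdge e (record { index = e ; rep = id ; idem = λ _ → ≡.refl })

      -- Incremental union-find: the classes of each constraint are the connected components of the
      -- subgraph of the edges collected under it so far.
      insert : E → List Constraint → List Constraint
      insert e []      = edgeConstraint e ∷ []
      insert e (C ∷ L) with compare e (index C)
      ... | inj₁ _ = mergeEdge e C ∷ L
      ... | inj₂ _ = C ∷ insert e L

      insert-comaximal-all : ∀ {a} e L → Comaximal a (label e) →
        All (λ C → Comaximal a (modulus C)) L → All (λ C → Comaximal a (modulus C)) (insert e L)
      insert-comaximal-all e []      pe []       = pe ∷ []
      insert-comaximal-all e (C ∷ L) pe (p ∷ ps) with compare e (index C)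
      ... | inj₁ _ = p ∷ ps
      ... | inj₂ _ = p ∷ insert-comaximal-all e L pe ps

      insert-comaximal : ∀ e L → AllPairs (λ C D → Comaximal (modulus C) (modulus D)) L →
        AllPairs (λ C D → Comaximal (modulus C) (modulus D)) (insert e L)
      insert-comaximal e []      []       = [] ∷ []
      insert-comaximal e (C ∷ L) (p ∷ ps) with compare e (index C)
      ... | inj₁ _   = p ∷ ps
      ... | inj₂ e#C = insert-comaximal-all e L (comaximal-sym e#C) p ∷ insert-comaximal e L ps

      -- Mutual divisibility of the labels turns the condition at `e` into a congruence modulo that
      -- of `C`, to which the merging lemmas apply.
      insert-satisfied : ∀ s e L →
        (EdgeSatisfied s e × All (λ C → Satisfied C s) L) ⇔ All (λ C → Satisfied C s) (insert e L)
      insert-satisfied s e [] = mk⇔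
        (λ (se , _) → sound se (λ _ → ~-refl) ∷ [])
        (λ { (sC ∷ []) → joins sC , [] })
        where
        open Merge e id s e
      insert-satisfied s e (C ∷ L) with compare e (index C)
      ... | inj₁ (e∣C , C∣e) = mk⇔
        (λ { (se , sC ∷ sL) → sound (∣ʳ-trans C∣e se) sC ∷ sL })
        (λ { (sC ∷ sL) → ∣ʳ-trans e∣C (joins sC) , refines (idem C) sC ∷ sL })
        where
        open Merge (index C) (rep C) s e
      ... | inj₂ _ = mk⇔
        (λ { (se , sC ∷ sL) → sC ∷ Equivalence.to (insert-satisfied s e L) (se , sL) })
        (λ { (sC ∷ sL) → let se , sL′ = Equivalence.from (insert-satisfied s e L) sL in se , sC ∷ sL′ })

      cluster : List E → List Constraint
      cluster = foldr insert []

      cluster-comaximal : ∀ es → AllPairs (λ C D → Comaximal (modulus C) (modulus D)) (cluster es)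
      cluster-comaximal []       = []
      cluster-comaximal (e ∷ es) = insert-comaximal e (cluster es) (cluster-comaximal es)

      cluster-satisfied : ∀ s es → All (EdgeSatisfied s) es ⇔ All (λ C → Satisfied C s) (cluster es)
      cluster-satisfied s []       = mk⇔ (λ _ → []) (λ _ → [])
      cluster-satisfied s (e ∷ es) = mk⇔
        (λ { (se ∷ ses) → Equivalence.to (insert-satisfied s e (cluster es))
               (se , Equivalence.to (cluster-satisfied s es) ses) })
        (λ sL → let se , sL′ = Equivalence.from (insert-satisfied s e (cluster es)) sL
                in se ∷ Equivalence.from (cluster-satisfied s es) sL′)

-- Diagonal coordinates on the spline module.

module _ {c ℓ} (em : ExcludedMiddle (c ⊔ ℓ)) {R : CommutativeRing c ℓ} (G : EdgeLabeledGraph R)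
         (principal : ∀ e → IsPrincipal (EdgeLabeledGraph.α G e))
         (disjoint : ∀ e f → ¬ (EdgeLabeledGraph.α G e ≈ᴵ EdgeLabeledGraph.α G f) →
                     (EdgeLabeledGraph.α G e +ᴵ EdgeLabeledGraph.α G f) ≈ᴵ unitIdeal) where
  open EdgeLabeledGraph G
  open CommutativeRing R
  open import Algebra.Properties.Semiring.Divisibility semiring
  private
    module RP = RingProperties ring

  open Ideal using (members)

  private
    generator : Edge → Carrier
    generator e = proj₁ (principal e)

    member⇒∣ : ∀ e {x} → members (α e) x → generator e ∣ x
    member⇒∣ e x∈ = let r , x≈ra = proj₁ (proj₂ (principal e)) x∈ in r , sym x≈ra

    ∣⇒member : ∀ e {x} → generator e ∣ x → members (α e) x
    ∣⇒member e (r , ra≈x) = proj₂ (proj₂ (principal e)) (r , sym ra≈x)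

    compare : ∀ e f → (generator e ∥ generator f) ⊎ Comaximal R (generator e) (generator f)
    compare e f with em {α e ≈ᴵ α f}
    ... | yes (e⊆f , f⊆e) = inj₁
      ( member⇒∣ e (f⊆e (∣⇒member f ∣ʳ-refl)) , member⇒∣ f (e⊆f (∣⇒member e ∣ʳ-refl)) )
    -- Distinct labels sum to the unit ideal. Writing 1 as `x + y`, the witness is `y`, for `1# - y`
    -- is `x`.
    ... | no e≉f = let x , y , x∈e , y∈f , 1≈x+y = proj₂ (disjoint e f e≉f) {1#} _ in inj₂
      (y , ∣ʳ-respʳ-≈ (sym (trans (+-congʳ 1≈x+y) (RP.//-rightDividesʳ y x))) (member⇒∣ e x∈e) , member⇒∣ f y∈f)

    edges = allFin #edges

    Δ = diagonalise R generator #vertices (cluster R generator #vertices ends compare edges)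
          (cluster-comaximal R generator #vertices ends compare edges)

    open Diagonalisation Δ
    module φ = Automorphism φ

    spline-∣ : ∀ (s : Spline G) v → d v ∣ φ.to (Spline.value s) v
    spline-∣ s = sound _ (Equivalence.to (cluster-satisfied R generator #vertices ends compare _ edges)
      (All.universal (λ e → member⇒∣ e (Spline.isSpline s e)) edges))

    -- The vector `d v` times the `v`-th standard unit vector, the intended image under `φ` of a
    -- basis spline.
    scaledUnit : Vertex → Vertex → Carrier
    scaledUnit v w with v ≟ w
    ... | yes _ = d w
    ... | no  _ = 0#

    scaledUnit-diagonal : ∀ v → scaledUnit v v ≈ d v
    scaledUnit-diagonal v with v ≟ v
    ... | yes _   = refl
    ... | no  v≢v = contradiction ≡.refl v≢v

    scaledUnit-off-diagonal : ∀ {v w} → v ≢ w → scaledUnit v w ≈ 0#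
    scaledUnit-off-diagonal {v} {w} v≢w with v ≟ w
    ... | yes v≡w = contradiction v≡w v≢w
    ... | no  _   = refl

    d∣scaledUnit : ∀ v w → d w ∣ scaledUnit v w
    d∣scaledUnit v w with v ≟ w
    ... | yes _ = ∣ʳ-refl
    ... | no  _ = d w ∣0

  splineCoordinates : DiagonalCoordinates (splineModule G) #vertices
  splineCoordinates = record
    { coordinate   = λ v s → φ.to (Spline.value s) v
    ; isFunctional = λ v → isLinear {M = splineModule G} {N = TensorUnit.⟨module⟩ {R = R}} _
        (λ s≈t → φ.to-cong s≈t v) (λ s t → φ.to-+ _ _ v) (λ r s → φ.to-* r _ v)
    ; injective    = λ s≈t v → trans (sym (φ.from∘to _ v)) (trans (φ.from-cong s≈t v) (φ.from∘to _ v))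
    ; d            = d
    ; d∣coordinate = λ v s → spline-∣ s v
    -- `complete` turns the divisibility of the entries of `scaledUnit v` into the edge conditions
    -- on its preimage.
    ; basis        = λ v → record
        { value    = φ.from (scaledUnit v)
        ; isSpline = λ e → ∣⇒member e (All.lookup
            (Equivalence.from (cluster-satisfied R generator #vertices ends compare _ edges)
              (complete _ (λ w → ∣ʳ-respʳ-≈ (sym (φ.to∘from _ w)) (d∣scaledUnit v w))))
            (∈-allFin e)) }
    ; diagonal     = λ v → trans (φ.to∘from _ v) (scaledUnit-diagonal v)
    ; off-diagonal = λ w≢v → trans (φ.to∘from _ _) (scaledUnit-off-diagonal w≢v)
    }

proposition2 : ∀ {c ℓ} (a ℓa : Level) → ExcludedMiddle (c ⊔ ℓ) →
    (R : CommutativeRing c ℓ) → IsIntegralDomain R → IsNoetherian R →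
    (G : EdgeLabeledGraph R) (let open EdgeLabeledGraph G) →
    (∀ e → IsPrincipal (α e)) →
    (∀ e f → ¬ (α e ≈ᴵ α f) → (α e +ᴵ α f) ≈ᴵ unitIdeal) →
    IsProjective a ℓa (splineModule G) ×
    (IsPID R ⊎ (∃ λ (A : CommutativeRing c ℓ) → ∃ λ (n : ℕ) → (IsPID A ⊎ IsField A) × R ≅ A [x₁⋯x n ]) →
    IsFree (splineModule G))
proposition2 {c} {ℓ} a ℓa em R R-domain _ G principal disjoint =
  diagonal⇒projective R-domain 0? D a ℓa , λ _ → diagonal⇒free R-domain 0? D
  where
  open CommutativeRing R
  D = splineCoordinates em G principal disjoint
  0? : ∀ x → Dec (x ≈ 0#)
  -- The equation is lifted to the level at which excluded middle is assumed.
  0? x = map′ lower lift (em {Lift c (x ≈ 0#)})
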